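{- There is an infinite overlap-free word $\mathbf{w}$ over the alphabet $\{0,1,2,3\}$ whose curling-number transform $C(\mathbf{w})$ is overlap-free.
   Context: Words are indexed from $0$; infinite words are one-sided, $\mathbf{w} = \mathbf{w}[0]\mathbf{w}[1]\cdots$; $x[i..j]$ denotes the factor (contiguous block) $x[i]\cdots x[j]$. An overlap is a word of the form $a x a x a$ with $a$ a single letter and $x$ a possibly empty word; a word is overlap-free if it contains no overlap as a factor. The curling number of a nonempty finite word $u$ is the largest integer $k \ge 1$ such that $u = y z^k$ for some (possibly empty) word $y$ and some nonempty word $z$. For a finite or infinite word $x$, the curling-number transform $C(x)$ is the word over the positive integers, of the same length as $x$, whose $i$-th letter $C(x)[i]$ is the curling number of the prefix $x[0..i]$. -}

module Defs where

open import Data.List using (List; []; _∷_; _++_; length; take; concat; replicate; applyUpTo)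
open import Data.List.Properties using (≡-dec; length-++; ++-identityʳ)
open import Data.Nat using (ℕ; zero; suc; _+_; _≤_; _<_; z≤n; s≤s; s≤s⁻¹)
open import Data.Nat.Properties
  using (anyUpTo?; ≤-refl; ≤-trans; ≤-reflexive; m≤n⇒m<n∨m≡n; m≤m+n; m≤n+m; +-mono-≤)
open import Data.Product using (∃-syntax; _×_; _,_)
open import Data.Sum using (inj₁; inj₂)
open import Function using (_∘_)
open import Relation.Binary.Definitions using (DecidableEquality)
open import Relation.Binary.PropositionalEquality
  using (_≡_; _≢_; refl; sym; trans; cong; cong₂; subst)
open import Relation.Nullary using (Dec; yes; no; ¬_; contradiction)
open import Relation.Nullary.Decidable using (map′; _×-dec_; ¬?)

Word : Set → Set
Word A = ℕ → A

-- The factor of length n starting at position i, i.e. w[i..i+n-1].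
factor : {A : Set} → Word A → ℕ → ℕ → List A
factor w i n = applyUpTo (λ k → w (i + k)) n

-- w[0..i], which has length i + 1.
prefix : {A : Set} → Word A → ℕ → List A
prefix w i = factor w 0 (suc i)

data IsOverlap {A : Set} : List A → Set where
  axaxa : (a : A) (x : List A) → IsOverlap (a ∷ x ++ a ∷ x ++ a ∷ [])

OverlapFree : {A : Set} → Word A → Set
OverlapFree w = ∀ i n → ¬ IsOverlap (factor w i n)

power : {A : Set} → List A → ℕ → List A
power z k = concat (replicate k z)

EndsInPower : {A : Set} → List A → ℕ → Set
EndsInPower u k = ∃[ y ] ∃[ z ] z ≢ [] × u ≡ y ++ power z k

record IsCurlingNumber {A : Set} (u : List A) (k : ℕ) : Set where
  field
    positive : 1 ≤ k
    attained : EndsInPower u k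
    maximal  : ∀ j → EndsInPower u j → j ≤ k

private
  variable
    A : Set

take-length-++ : (z v : List A) → take (length z) (z ++ v) ≡ z
take-length-++ []      v = refl
take-length-++ (a ∷ z) v = cong (a ∷_) (take-length-++ z v)

nonempty-length : (z : List A) → z ≢ [] → 1 ≤ length z
nonempty-length []      z≢[] = contradiction refl z≢[]
nonempty-length (_ ∷ _) _    = s≤s z≤n

k≤length-power : (z : List A) → z ≢ [] → ∀ k → k ≤ length (power z k)
k≤length-power z z≢[] zero    = z≤n
k≤length-power z z≢[] (suc k) =
  subst (suc k ≤_) (sym (length-++ z))
    (+-mono-≤ (nonempty-length z z≢[]) (k≤length-power z z≢[] k))

k≤length : (u : List A) → ∀ k → EndsInPower u k → k ≤ length u
k≤length _ k (y , z , z≢[] , refl) =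
  subst (k ≤_) (sym (length-++ y))
    (≤-trans (k≤length-power z z≢[] k) (m≤n+m _ (length y)))

IsPower : List A → ℕ → Set
IsPower u k = ∃[ z ] z ≢ [] × u ≡ power z k

empty? : (u : List A) → Dec (u ≡ [])
empty? []      = yes refl
empty? (_ ∷ _) = no λ ()

isPower? : DecidableEquality A → (u : List A) → ∀ k → Dec (IsPower u (suc k))
isPower? {A} _≟_ u k = map′ to from (anyUpTo? root? (suc (length u)))
  where
  Root : ℕ → Set
  Root p = take p u ≢ [] × u ≡ power (take p u) (suc k)

  root? : ∀ p → Dec (Root p)
  root? p = ¬? (empty? (take p u)) ×-dec ≡-dec _≟_ u (power (take p u) (suc k))

  to : ∃[ p ] p < suc (length u) × Root p → IsPower u (suc k)
  to (p , _ , nonempty , eq) = take p u , nonempty , eq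

  from : IsPower u (suc k) → ∃[ p ] p < suc (length u) × Root p
  from (z , z≢[] , eq) = length z , s≤s short , z≢[] ∘ trans (sym takes) , root
    where
    takes : take (length z) u ≡ z
    takes = trans (cong (take (length z)) eq) (take-length-++ z (power z k))

    short : length z ≤ length u
    short = ≤-trans (m≤m+n _ _) (≤-reflexive (sym (trans (cong length eq) (length-++ z))))

    root : u ≡ power (take (length z) u) (suc k)
    root = trans eq (cong (λ v → power v (suc k)) (sym takes))

endsInPower? : DecidableEquality A → (u : List A) → ∀ k → Dec (EndsInPower u (suc k))
endsInPower? _≟_ [] k = no λ e → contradiction (k≤length [] (suc k) e) λ ()
endsInPower? _≟_ (a ∷ u) k with isPower? _≟_ (a ∷ u) k | endsInPower? _≟_ u k
... | yes (z , z≢[] , eq) | _ = yes ([] , z , z≢[] , eq)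
... | no _ | yes (y , z , z≢[] , eq) = yes (a ∷ y , z , z≢[] , cong (a ∷_) eq)
... | no ¬whole | no ¬tail = no λ where
  ([] , z , z≢[] , eq)       → ¬whole (z , z≢[] , eq)
  (_ ∷ y , z , z≢[] , refl)  → ¬tail (y , z , z≢[] , refl)

-- The largest k with 1 ≤ k ≤ n such that u ends in a k-th power, or 0 if there is none.
greatest : DecidableEquality A → List A → ℕ → ℕ
greatest _≟_ u zero = 0
greatest _≟_ u (suc n) with endsInPower? _≟_ u n
... | yes _ = suc n
... | no  _ = greatest _≟_ u n

greatest-maximal : (_≟_ : DecidableEquality A) (u : List A) → ∀ n j → j ≤ n →
                   EndsInPower u j → j ≤ greatest _≟_ u n
greatest-maximal _≟_ u zero    j j≤n e = j≤n
greatest-maximal _≟_ u (suc n) j j≤n e with endsInPower? _≟_ u n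
... | yes _ = j≤n
... | no ¬e with m≤n⇒m<n∨m≡n j≤n
...   | inj₁ j<1+n = greatest-maximal _≟_ u n j (s≤s⁻¹ j<1+n) e
...   | inj₂ refl  = contradiction e ¬e

greatest-attained : (_≟_ : DecidableEquality A) (u : List A) → ∀ n →
                    1 ≤ greatest _≟_ u n → EndsInPower u (greatest _≟_ u n)
greatest-attained _≟_ u (suc n) pos with endsInPower? _≟_ u n
... | yes e = e
... | no  _ = greatest-attained _≟_ u n pos

-- Every k with u ≡ y ++ power z k and z nonempty is at most length u, so the
-- search is bounded by length u.  The empty word gets the junk value 0.
curlingNumber : DecidableEquality A → List A → ℕ
curlingNumber _≟_ u = greatest _≟_ u (length u)

curlingNumber-correct : (_≟_ : DecidableEquality A) (u : List A) → u ≢ [] →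
                        IsCurlingNumber u (curlingNumber _≟_ u)
curlingNumber-correct _≟_ u u≢[] = record
  { positive = pos
  ; attained = greatest-attained _≟_ u (length u) pos
  ; maximal  = maximal
  }
  where
  maximal : ∀ j → EndsInPower u j → j ≤ curlingNumber _≟_ u
  maximal j e = greatest-maximal _≟_ u (length u) j (k≤length u j e) e

  pos : 1 ≤ curlingNumber _≟_ u
  pos = maximal 1 ([] , u , u≢[] , sym (++-identityʳ u))

C : DecidableEquality A → Word A → Word ℕ
C _≟_ w i = curlingNumber _≟_ (prefix w i)

{-# OPTIONS --safe #-}

-- Let t be the Thue–Morse word and let W be the word whose j-th block of 32
-- letters is one of four fixed words, selected by the pair (t[j], t[j+1]); the
-- answer w is a suffix of W.  The blocks are chosen so that every 2 of C(w) comes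
-- from a square of period at most 5, every square of period below 35 ends where a
-- 2 is wanted, and C(w)[n] = 1 + t[n+27].  Long squares do not exist: a factor of
-- length 4 starting at offset 16 of a block occurs at no other offset, so a long
-- period is a multiple 32p of the block length, and since the letter at offset 16
-- encodes (t[j], t[j+1]), the square would give an overlap of period p in t.  All
-- other assertions concern factors of W of bounded length, and as t has only 12
-- factors of length 5, which occur at its first 12 positions, these are covered
-- by the factors starting in the first 12 blocks of W.

module Submission where

open import Defs
open import Data.Bool using (Bool; true; false; not; _xor_)
import Data.Bool.Properties as Bool
open import Data.Empty using (⊥-elim)
open import Data.Fin using (Fin; _≟_)
open import Data.Fin.Patterns using (0F; 1F; 2F; 3F)
open import Data.Fin.Properties using (fromℕ<-cong)
open import Data.List using (List; []; _∷_; _++_; length; applyUpTo)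
open import Data.List.Properties using (∷-injectiveˡ; ∷-injectiveʳ; ++-assoc; ++-identityʳ)
open import Data.Nat
  using (ℕ; zero; suc; NonZero; _+_; _*_; _∸_; _%_; _/_; _≡ᵇ_; _≤_; _<_; _<?_; s≤s; s≤s⁻¹; z<s; s<s)
import Data.Nat as ℕ
open import Data.Nat.Divisibility using (_∣_; divides; n∣m*n; ∣m+n∣m⇒∣n)
open import Data.Nat.DivMod
open import Data.Nat.Induction using (<-rec)
open import Data.Nat.Properties hiding (_≟_; _<?_)
open import Algebra.Properties.CommutativeSemigroup +-commutativeSemigroup
  using () renaming (x∙yz≈y∙xz to +-swap)
open import Data.Product using (∃-syntax; _×_; _,_; proj₁; proj₂)
open import Data.Sum using (_⊎_; inj₁; inj₂)
open import Data.Vec using (Vec; []; _∷_; lookup)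
open import Function using (_∘_)
open import Relation.Binary.Definitions using (DecidableEquality)
open import Relation.Binary.PropositionalEquality
open import Relation.Nullary using (Dec; yes; no; ¬_; contradiction)
open import Relation.Nullary.Decidable using (_×-dec_; _→-dec_; ¬?; from-yes)
open ≡-Reasoning

-- Factors, squares and overlaps by position

Square : {A : Set} → Word A → ℕ → ℕ → Set
Square w i p = ∀ {k} → k < p → w (i + k) ≡ w (i + (p + k))

square? : {A : Set} → DecidableEquality A → (w : Word A) → ∀ i p → Dec (Square w i p)
square? _≟_ w i p = allUpTo? (λ k → w (i + k) ≟ w (i + (p + k))) p

-- For positive `p` this is the shape `axaxa` with `p` the length of `ax`: the one comparison beyond
-- `Square` accounts for the last `a`.
Overlap : {A : Set} → Word A → ℕ → ℕ → Set
Overlap w i p = ∀ {k} → k < suc p → w (i + k) ≡ w (i + (p + k))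

NoOverlap : {A : Set} → Word A → Set
NoOverlap u = ∀ i p → ¬ Overlap u i (suc p)

SquareEndingAt : {A : Set} → Word A → ℕ → Set
SquareEndingAt w n = ∃[ i ] ∃[ p ] i + (suc p + suc p) ≡ suc n × Square w i (suc p)

Agree : {A : Set} → Word A → ℕ → ℕ → ℕ → Set
Agree u i j n = ∀ {k} → k < n → u (i + k) ≡ u (j + k)

agree? : {A : Set} → DecidableEquality A → (u : Word A) → ∀ i j n → Dec (Agree u i j n)
agree? _≟_ u i j n = allUpTo? (λ k → u (i + k) ≟ u (j + k)) n

agree-shift : {A : Set} (u : Word A) → ∀ i j {m n} d → d + n ≤ m →
              Agree u i j m → Agree u (i + d) (j + d) n
agree-shift u i j d d+n≤m ag {k} k<n = begin
  u (i + d + k)    ≡⟨ cong u (+-assoc i d k) ⟩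
  u (i + (d + k))  ≡⟨ ag (<-≤-trans (+-monoʳ-< d k<n) d+n≤m) ⟩
  u (j + (d + k))  ≡⟨ cong u (+-assoc j d k) ⟨
  u (j + d + k)    ∎

module _ {A : Set} where

  applyUpTo-cong : (f g : ℕ → A) → ∀ n → (∀ {k} → k < n → f k ≡ g k) → applyUpTo f n ≡ applyUpTo g n
  applyUpTo-cong f g zero    eq = refl
  applyUpTo-cong f g (suc n) eq = cong₂ _∷_ (eq z<s) (applyUpTo-cong (f ∘ suc) (g ∘ suc) n (eq ∘ s<s))

  applyUpTo-injective : (f g : ℕ → A) → ∀ n → applyUpTo f n ≡ applyUpTo g n →
                        ∀ {k} → k < n → f k ≡ g k
  applyUpTo-injective f g (suc n) eq {zero}  _         = ∷-injectiveˡ eq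
  applyUpTo-injective f g (suc n) eq {suc k} (s≤s k<n) =
    applyUpTo-injective (f ∘ suc) (g ∘ suc) n (∷-injectiveʳ eq) k<n

  applyUpTo-+ : (f : ℕ → A) → ∀ m n → applyUpTo f (m + n) ≡ applyUpTo f m ++ applyUpTo (λ k → f (m + k)) n
  applyUpTo-+ f zero    n = refl
  applyUpTo-+ f (suc m) n = cong (f 0 ∷_) (applyUpTo-+ (f ∘ suc) m n)

  applyUpTo-++⁻ : (f : ℕ → A) → ∀ n xs {ys} → applyUpTo f n ≡ xs ++ ys →
                  ∃[ m ] n ≡ length xs + m × applyUpTo f (length xs) ≡ xs ×
                         applyUpTo (λ k → f (length xs + k)) m ≡ ys
  applyUpTo-++⁻ f n       []       eq = n , refl , refl , eq
  applyUpTo-++⁻ f (suc n) (x ∷ xs) eq =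
    let m , n≡ , eq₁ , eq₂ = applyUpTo-++⁻ (f ∘ suc) n xs (∷-injectiveʳ eq)
    in m , cong suc n≡ , cong₂ _∷_ (∷-injectiveˡ eq) eq₁ , eq₂

  square-++ : (u : Word A) → ∀ n y z {v} → applyUpTo u n ≡ y ++ (z ++ (z ++ v)) →
              Square u (length y) (length z) ×
              applyUpTo (λ k → u (length y + (length z + k))) (length z) ≡ z ×
              ∃[ m ] n ≡ length y + (length z + (length z + m)) ×
                     applyUpTo (λ k → u (length y + (length z + (length z + k)))) m ≡ v
  square-++ u n y z eq =
    let a , n≡ , _   , eq₁ = applyUpTo-++⁻ u n y eq
        b , a≡ , z≡₁ , eq₂ = applyUpTo-++⁻ _ a z eq₁
        c , b≡ , z≡₂ , eq₃ = applyUpTo-++⁻ _ b z eq₂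
    in applyUpTo-injective _ _ (length z) (trans z≡₁ (sym z≡₂))
     , z≡₂
     , c
     , trans n≡ (cong (length y +_) (trans a≡ (cong (length z +_) b≡)))
     , eq₃

  -- The tail `v` is left free so that cubes are covered too: there `v` is the rest of the third
  -- copy.
  overlap-++ : (u : Word A) → ∀ n y a x {v} → applyUpTo u n ≡ y ++ ((a ∷ x) ++ ((a ∷ x) ++ (a ∷ v))) →
               Overlap u (length y) (length (a ∷ x))
  overlap-++ u n y a x eq {k} k≤p with square-++ u n y (a ∷ x) eq | m≤n⇒m<n∨m≡n (s≤s⁻¹ k≤p)
  ... | sq , _                    | inj₁ k<p  = sq k<p
  ... | _ , z≡ , suc m , _ , v≡ | inj₂ refl = begin
    u (e + p)              ≡⟨ cong (λ q → u (e + q)) (+-identityʳ p) ⟨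
    u (e + (p + 0))        ≡⟨ ∷-injectiveˡ z≡ ⟩
    a                      ≡⟨ ∷-injectiveˡ v≡ ⟨
    u (e + (p + (p + 0)))  ≡⟨ cong (λ q → u (e + (p + q))) (+-identityʳ p) ⟩
    u (e + (p + p))        ∎
    where
    e = length y
    p = length (a ∷ x)

  NoOverlap⇒OverlapFree : (u : Word A) → NoOverlap u → OverlapFree u
  NoOverlap⇒OverlapFree u no-ov i n = absurd refl
    where
    -- The factor is generalised to a variable `v`, because `factor u i n` cannot be unified with
    -- the index of `axaxa`.
    absurd : ∀ {v} → factor u i n ≡ v → ¬ IsOverlap v
    absurd eq (axaxa a x) = no-ov i (length x) λ {k} k≤p →
      overlap-++ (λ k → u (i + k)) n [] a x eq k≤p

  power-+ : (z : List A) → ∀ j k → power z (j + k) ≡ power z j ++ power z k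
  power-+ z zero    k = refl
  power-+ z (suc j) k = trans (cong (z ++_) (power-+ z j k)) (sym (++-assoc z (power z j) (power z k)))

  EndsInPower-drop : (v : List A) → ∀ j k → EndsInPower v (j + k) → EndsInPower v k
  EndsInPower-drop v j k (y , z , z≢[] , eq) = y ++ power z j , z , z≢[] ,
    trans eq (trans (cong (y ++_) (power-+ z j k)) (sym (++-assoc y (power z j) (power z k))))

  endsInSquare⇒square : (u : Word A) → ∀ n → EndsInPower (prefix u n) 2 → SquareEndingAt u n
  endsInSquare⇒square u n (y , []         , z≢[] , eq) = contradiction refl z≢[]
  endsInSquare⇒square u n (y , z@(_ ∷ x) , z≢[] , eq) with square-++ u (suc n) y z eq
  ... | sq , _ , zero , n≡ , _ =
    length y , length x , trans (cong (λ q → length y + (length z + q)) (sym (+-identityʳ _))) (sym n≡) , sq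

  square⇒endsInSquare : (u : Word A) → ∀ n → SquareEndingAt u n → EndsInPower (prefix u n) 2
  square⇒endsInSquare u n (i , p , end , sq) = applyUpTo u i , z , (λ ()) , (begin
    applyUpTo u (suc n)                                ≡⟨ cong (applyUpTo u) end ⟨
    applyUpTo u (i + (suc p + suc p))                  ≡⟨ applyUpTo-+ u i (suc p + suc p) ⟩
    applyUpTo u i ++ applyUpTo (λ k → u (i + k)) (suc p + suc p)
      ≡⟨ cong (applyUpTo u i ++_) (applyUpTo-+ (λ k → u (i + k)) (suc p) (suc p)) ⟩
    applyUpTo u i ++ (z ++ applyUpTo (λ k → u (i + (suc p + k))) (suc p))
      ≡⟨ cong (λ v → applyUpTo u i ++ (z ++ v)) (applyUpTo-cong _ _ (suc p) sq) ⟨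
    applyUpTo u i ++ (z ++ z)                          ≡⟨ cong (λ v → applyUpTo u i ++ (z ++ v)) (++-identityʳ z) ⟨
    applyUpTo u i ++ power z 2                         ∎)
    where
    z = applyUpTo (λ k → u (i + k)) (suc p)

  NoOverlap⇒¬endsInCube : (u : Word A) → NoOverlap u → ∀ n → ¬ EndsInPower (prefix u n) 3
  NoOverlap⇒¬endsInCube u no-ov n (y , []    , z≢[] , eq) = z≢[] refl
  NoOverlap⇒¬endsInCube u no-ov n (y , a ∷ x , z≢[] , eq) =
    no-ov (length y) (length x) λ k≤p → overlap-++ u (suc n) y a x eq k≤p

  module _ (_≟_ : DecidableEquality A) (u : Word A) (n : ℕ) where
    open IsCurlingNumber (curlingNumber-correct _≟_ (prefix u n) λ ())

    -- The square gives at least 2. A larger value would leave a cube at the end, and a cube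
    -- contains an overlap.
    C≡2 : NoOverlap u → SquareEndingAt u n → C _≟_ u n ≡ 2
    C≡2 no-ov sq with C _≟_ u n | attained | maximal 2 (square⇒endsInSquare u n sq)
    ... | suc (suc zero)    | _ | _ = refl
    ... | suc (suc (suc j)) | e | _ = contradiction
      (EndsInPower-drop _ j 3 (subst (EndsInPower (prefix u n)) (+-comm 3 j) e))
      (NoOverlap⇒¬endsInCube u no-ov n)
    ... | suc zero | _ | s≤s ()

    C≡1 : ¬ SquareEndingAt u n → C _≟_ u n ≡ 1
    C≡1 ¬sq with C _≟_ u n | attained | positive
    ... | suc zero    | _ | _ = refl
    ... | suc (suc j) | e | _ = contradiction
      (endsInSquare⇒square u n (EndsInPower-drop _ j 2 (subst (EndsInPower (prefix u n)) (+-comm 2 j) e)))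
      ¬sq

-- The Thue–Morse word

[m+kn]/n≡m/n+k : ∀ m k n .{{_ : NonZero n}} → (m + k * n) / n ≡ m / n + k
[m+kn]/n≡m/n+k m k n =
  trans (+-distrib-/-∣ʳ m (n∣m*n k)) (cong (m / n +_) (m*n/n≡m k n))

[kn+m]/n≡k+m/n : ∀ k m n .{{_ : NonZero n}} → (k * n + m) / n ≡ k + m / n
[kn+m]/n≡k+m/n k m n = begin
  (k * n + m) / n  ≡⟨ cong (_/ n) (+-comm (k * n) m) ⟩
  (m + k * n) / n  ≡⟨ [m+kn]/n≡m/n+k m k n ⟩
  m / n + k        ≡⟨ +-comm (m / n) k ⟩
  k + m / n        ∎

[kn+m]%n≡m%n : ∀ k m n .{{_ : NonZero n}} → (k * n + m) % n ≡ m % n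
[kn+m]%n≡m%n k m n = trans (cong (_% n) (+-comm (k * n) m)) ([m+kn]%n≡m%n m k n)

m/n*n+m%n≡m : ∀ m n .{{_ : NonZero n}} → m / n * n + m % n ≡ m
m/n*n+m%n≡m m n = trans (+-comm (m / n * n) (m % n)) (sym (m≡m%n+[m/n]*n m n))

odd : ℕ → Bool
odd n = n % 2 ≡ᵇ 1

-- The first argument bounds the number of binary digits read.
digitSum : ℕ → ℕ → Bool
digitSum zero    n         = false
digitSum (suc f) zero      = false
digitSum (suc f) n@(suc _) = odd n xor digitSum f (n / 2)

t : Word Bool
t n = digitSum n n

digitSum-stable : ∀ f g n → n ≤ f → n ≤ g → digitSum f n ≡ digitSum g n
digitSum-stable zero    zero    zero    _ _ = refl
digitSum-stable zero    (suc g) zero    _ _ = refl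
digitSum-stable (suc f) zero    zero    _ _ = refl
digitSum-stable (suc f) (suc g) zero    _ _ = refl
digitSum-stable (suc f) (suc g) (suc n) (s≤s n≤f) (s≤s n≤g) =
  cong (odd (suc n) xor_)
    (digitSum-stable f g (suc n / 2) (≤-trans half≤n n≤f) (≤-trans half≤n n≤g))
  where
  half≤n : suc n / 2 ≤ n
  half≤n = s≤s⁻¹ (m/n<m (suc n) 2 (s<s z<s))

t-step : ∀ n → t n ≡ odd n xor t (n / 2)
t-step zero      = refl
t-step n@(suc m) = cong (odd n xor_)
  (digitSum-stable m (n / 2) (n / 2) (s≤s⁻¹ (m/n<m n 2 (s<s z<s))) ≤-refl)

-- Here `m` need not be a single digit, so it can also be a starting position or an offset inside a
-- factor.
t-digit : ∀ h m → t (h * 2 + m) ≡ odd m xor t (h + m / 2)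
t-digit h m = begin
  t (h * 2 + m)
    ≡⟨ t-step (h * 2 + m) ⟩
  odd (h * 2 + m) xor t ((h * 2 + m) / 2)
    ≡⟨ cong₂ (λ x y → (x ≡ᵇ 1) xor t y) ([kn+m]%n≡m%n h m 2) ([kn+m]/n≡k+m/n h m 2) ⟩
  odd m xor t (h + m / 2) ∎

t-even : ∀ h → t (h * 2) ≡ t h
t-even h = begin
  t (h * 2)      ≡⟨ cong t (+-identityʳ (h * 2)) ⟨
  t (h * 2 + 0)  ≡⟨ t-digit h 0 ⟩
  t (h + 0)      ≡⟨ cong t (+-identityʳ h) ⟩
  t h            ∎

t-odd : ∀ h → t (suc (h * 2)) ≡ not (t (h * 2))
t-odd h = begin
  t (suc (h * 2))  ≡⟨ cong t (+-comm 1 (h * 2)) ⟩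
  t (h * 2 + 1)    ≡⟨ t-digit h 1 ⟩
  not (t (h + 0))  ≡⟨ cong (not ∘ t) (+-identityʳ h) ⟩
  not (t h)        ≡⟨ cong not (t-even h) ⟨
  not (t (h * 2))  ∎

xor-cancelˡ : ∀ b {x y} → b xor x ≡ b xor y → x ≡ y
xor-cancelˡ false eq = eq
xor-cancelˡ true  eq = Bool.not-injective eq

parity : ∀ n → ∃[ h ] (n ≡ h * 2 ⊎ n ≡ suc (h * 2))
parity zero    = 0 , inj₁ refl
parity (suc n) with parity n
... | h , inj₁ eq = h , inj₂ (cong suc eq)
... | h , inj₂ eq = suc h , inj₁ (cong suc eq)

-- Only the positions `i + k * 2` are compared. They share the last binary digit of `i`, which
-- cancels.
overlap-halve : ∀ i q → Overlap t i (q * 2) → Overlap t (i / 2) q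
overlap-halve i q ov {k} k≤q = xor-cancelˡ (odd i) (begin
  odd i xor t (i / 2 + k)        ≡⟨ cong (λ n → odd i xor t n) (+-comm (i / 2) k) ⟩
  odd i xor t (k + i / 2)        ≡⟨ t-digit k i ⟨
  t (k * 2 + i)                  ≡⟨ cong t (+-comm (k * 2) i) ⟩
  t (i + k * 2)                  ≡⟨ ov (s≤s (*-monoˡ-≤ 2 (s≤s⁻¹ k≤q))) ⟩
  t (i + (q * 2 + k * 2))        ≡⟨ cong (λ n → t (i + n)) (*-distribʳ-+ 2 q k) ⟨
  t (i + (q + k) * 2)            ≡⟨ cong t (+-comm i ((q + k) * 2)) ⟩
  t ((q + k) * 2 + i)            ≡⟨ t-digit (q + k) i ⟩
  odd i xor t (q + k + i / 2)    ≡⟨ cong (λ n → odd i xor t n) (+-comm (q + k) (i / 2)) ⟩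
  odd i xor t (i / 2 + (q + k))  ∎)

-- t changes from every even position to the next, and an odd period carries
-- this over to the odd positions.
odd-period-alternates : ∀ i q → Overlap t i (suc (q * 2)) →
                        ∀ {k} → k < suc (q * 2) → t (i + suc k) ≡ not (t (i + k))
odd-period-alternates i q ov {k} k<p with parity (i + k)
... | h , inj₁ even = begin
  t (i + suc k)    ≡⟨ cong t (+-suc i k) ⟩
  t (suc (i + k))  ≡⟨ cong (t ∘ suc) even ⟩
  t (suc (h * 2))  ≡⟨ t-odd h ⟩
  not (t (h * 2))  ≡⟨ cong (not ∘ t) even ⟨
  not (t (i + k))  ∎
... | h , inj₂ odd′ = begin
  t (i + suc k)              ≡⟨ ov (s<s k<p) ⟩
  t (i + (p + suc k))        ≡⟨ cong t (trans (cong (i +_) (+-suc p k)) (+-suc i (p + k))) ⟩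
  t (suc (i + (p + k)))      ≡⟨ cong (t ∘ suc) even ⟩
  t (suc ((suc q + h) * 2))  ≡⟨ t-odd (suc q + h) ⟩
  not (t ((suc q + h) * 2))  ≡⟨ cong (not ∘ t) even ⟨
  not (t (i + (p + k)))      ≡⟨ cong not (ov (m≤n⇒m≤1+n k<p)) ⟨
  not (t (i + k))            ∎
  where
  p = suc (q * 2)
  even : i + (p + k) ≡ (suc q + h) * 2
  even = begin
    i + (p + k)            ≡⟨ +-assoc i p k ⟨
    i + p + k              ≡⟨ cong (_+ k) (+-comm i p) ⟩
    p + i + k              ≡⟨ +-assoc p i k ⟩
    p + (i + k)            ≡⟨ cong (p +_) odd′ ⟩
    p + suc (h * 2)        ≡⟨ +-suc p (h * 2) ⟩
    suc q * 2 + h * 2      ≡⟨ *-distribʳ-+ 2 (suc q) h ⟨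
    (suc q + h) * 2        ∎

-- The number of changes is odd; they cancel in pairs and one remains.
alternation : ∀ i q → (∀ {k} → k < suc (q * 2) → t (i + suc k) ≡ not (t (i + k))) →
              t (i + suc (q * 2)) ≡ not (t (i + 0))
alternation i zero    alt = alt z<s
alternation i (suc q) alt = begin
  t (i + suc (suc q * 2))            ≡⟨ alt ≤-refl ⟩
  not (t (i + suc (suc (q * 2))))    ≡⟨ cong not (alt (m≤n⇒m≤1+n ≤-refl)) ⟩
  not (not (t (i + suc (q * 2))))    ≡⟨ Bool.not-involutive _ ⟩
  t (i + suc (q * 2))                ≡⟨ alternation i q (λ k<p → alt (m≤n⇒m≤1+n (m≤n⇒m≤1+n k<p))) ⟩
  not (t (i + 0))                    ∎

-- Descent on the period `suc p`. An odd period (`p` even) forces alternation, which contradicts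
-- equality of the letters one period apart; an even period halves.
t-no-overlap : ∀ p i → ¬ Overlap t i (suc p)
t-no-overlap = <-rec (λ p → ∀ i → ¬ Overlap t i (suc p)) step
  where
  step : ∀ p → (∀ {q} → q < p → ∀ i → ¬ Overlap t i (suc q)) → ∀ i → ¬ Overlap t i (suc p)
  step p rec i ov with parity p
  ... | q , inj₁ refl = Bool.not-¬
    (sym (trans (ov z<s) (cong (λ n → t (i + n)) (+-identityʳ (suc (q * 2))))))
    (alternation i q (odd-period-alternates i q ov))
  ... | q , inj₂ refl = rec (s≤s (m≤m*n q 2)) (i / 2) (overlap-halve i (suc q) ov)

-- Recurrence of the Thue-Morse factors of length 5

-- The factor at `i * 2` is the image of the factor at `i` under the morphism 0 ↦ 01, 1 ↦ 10.
agree-double : ∀ i j n → Agree t i j n → Agree t (i * 2) (j * 2) (n * 2)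
agree-double i j n ag {k} k<2n = begin
  t (i * 2 + k)            ≡⟨ t-digit i k ⟩
  odd k xor t (i + k / 2)  ≡⟨ cong (odd k xor_) (ag (m<n*o⇒m/o<n k<2n)) ⟩
  odd k xor t (j + k / 2)  ≡⟨ t-digit j k ⟨
  t (j * 2 + k)            ∎

n*2⁵≡n*32 : ∀ n → n * 2 * 2 * 2 * 2 * 2 ≡ n * 32
n*2⁵≡n*32 n = begin
  n * 2 * 2 * 2 * 2 * 2  ≡⟨ *-assoc (n * 2 * 2 * 2) 2 2 ⟩
  n * 2 * 2 * 2 * 4      ≡⟨ *-assoc (n * 2 * 2) 2 4 ⟩
  n * 2 * 2 * 8          ≡⟨ *-assoc (n * 2) 2 8 ⟩
  n * 2 * 16             ≡⟨ *-assoc n 2 16 ⟩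
  n * 32                 ∎

agree-32 : ∀ i j → Agree t i j 5 → Agree t (i * 32) (j * 32) 160
agree-32 i j ag = subst₂ (λ x y → Agree t x y 160) (n*2⁵≡n*32 i) (n*2⁵≡n*32 j)
  (agree-double (i * 2 * 2 * 2 * 2) (j * 2 * 2 * 2 * 2) 80
  (agree-double (i * 2 * 2 * 2) (j * 2 * 2 * 2) 40
  (agree-double (i * 2 * 2) (j * 2 * 2) 20
  (agree-double (i * 2) (j * 2) 10
  (agree-double i j 5 ag)))))

abstract
  -- The bound 24 covers all `h′ * 2 + d` with `h′ < 12` and `d < 2`, the positions met in the
  -- induction below.
  t-recurrence-24 : ∀ {j} → j < 24 → ∃[ j′ ] j′ < 12 × Agree t j j′ 5
  t-recurrence-24 = from-yes (allUpTo? (λ j → anyUpTo? (λ j′ → agree? Bool._≟_ t j j′ 5) 12) 24)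

-- The factor at `j` lies inside the image of the factor at `j / 2`. Induction moves the latter
-- below 12, hence the former below 24, and the finite check finishes.
t-recurrence : ∀ j → ∃[ j′ ] j′ < 12 × Agree t j j′ 5
t-recurrence = <-rec (λ j → ∃[ j′ ] j′ < 12 × Agree t j j′ 5) step
  where
  step : ∀ j → (∀ {i} → i < j → ∃[ i′ ] i′ < 12 × Agree t i i′ 5) → ∃[ j′ ] j′ < 12 × Agree t j j′ 5
  step zero      rec = 0 , z<s , λ _ → refl
  step j@(suc _) rec =
    let h′ , h′<12 , ag = rec (m/n<m j 2 (s<s z<s))
        d<2 = m%n<n j 2
        ag₁ : Agree t j (h′ * 2 + j % 2) 5
        ag₁ = subst (λ x → Agree t x (h′ * 2 + j % 2) 5) (m/n*n+m%n≡m j 2)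
                (agree-shift t (j / 2 * 2) (h′ * 2) (j % 2) (+-mono-≤ (<⇒≤ d<2) (m≤m+n 5 3))
                  (agree-double (j / 2) h′ 5 ag))
        j′ , j′<12 , ag₂ = t-recurrence-24 (<-≤-trans (+-monoʳ-< (h′ * 2) d<2)
                             (subst (_≤ 24) (+-comm 2 (h′ * 2)) (*-monoˡ-≤ 2 h′<12)))
    in j′ , j′<12 , λ k<5 → trans (ag₁ k<5) (ag₂ k<5)

-- The word W

-- Found by computer search.
block : Bool → Bool → Vec (Fin 4) 32
block false false =
  0F ∷ 3F ∷ 2F ∷ 2F ∷ 0F ∷ 0F ∷ 3F ∷ 1F ∷ 3F ∷ 1F ∷ 1F ∷ 0F ∷ 0F ∷ 2F ∷ 1F ∷ 1F ∷
  0F ∷ 0F ∷ 2F ∷ 0F ∷ 0F ∷ 1F ∷ 0F ∷ 0F ∷ 1F ∷ 2F ∷ 0F ∷ 0F ∷ 1F ∷ 2F ∷ 2F ∷ 0F ∷ []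
block false true =
  0F ∷ 3F ∷ 2F ∷ 2F ∷ 0F ∷ 0F ∷ 3F ∷ 1F ∷ 3F ∷ 1F ∷ 1F ∷ 2F ∷ 2F ∷ 3F ∷ 2F ∷ 2F ∷
  3F ∷ 0F ∷ 2F ∷ 2F ∷ 3F ∷ 0F ∷ 0F ∷ 3F ∷ 0F ∷ 3F ∷ 3F ∷ 0F ∷ 3F ∷ 2F ∷ 3F ∷ 3F ∷ []
block true false =
  2F ∷ 3F ∷ 2F ∷ 1F ∷ 1F ∷ 3F ∷ 1F ∷ 1F ∷ 3F ∷ 2F ∷ 1F ∷ 1F ∷ 3F ∷ 2F ∷ 2F ∷ 3F ∷
  2F ∷ 3F ∷ 3F ∷ 0F ∷ 0F ∷ 1F ∷ 0F ∷ 0F ∷ 1F ∷ 2F ∷ 0F ∷ 0F ∷ 1F ∷ 2F ∷ 2F ∷ 0F ∷ []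
block true true =
  2F ∷ 3F ∷ 2F ∷ 1F ∷ 1F ∷ 3F ∷ 1F ∷ 1F ∷ 3F ∷ 2F ∷ 1F ∷ 1F ∷ 3F ∷ 2F ∷ 2F ∷ 1F ∷
  1F ∷ 0F ∷ 2F ∷ 2F ∷ 1F ∷ 1F ∷ 0F ∷ 3F ∷ 0F ∷ 3F ∷ 3F ∷ 0F ∷ 3F ∷ 2F ∷ 3F ∷ 3F ∷ []

W : Word (Fin 4)
W n = lookup (block (t (n / 32)) (t (suc (n / 32)))) (n mod 32)

-- bit n says whether a square is meant to end at position n of W.  The shift by 16
-- pairs block j of W with the second half of the image of t[j] and the first half
-- of the image of t[j+1] under the fifth power of the Thue–Morse morphism.
bit : Word Bool
bit n = t (16 + n)

-- Position 11 of W is such that no square witnessing a 2 further right has to start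
-- before it.
w : Word (Fin 4)
w n = W (11 + n)

-- Finite checks on the first 12 blocks

abstract
  -- Here 384 is 12 blocks of 32 letters, the periods are 1 to 34, and `n + (p + suc p)` is the last
  -- position of the square.
  short-square-bit : ∀ {n} → n < 384 → ∀ {p} → p < 34 → Square W n (suc p) →
                     bit (n + (p + suc p)) ≡ true
  short-square-bit = from-yes (allUpTo? (λ n → allUpTo? (λ p →
    square? _≟_ W n (suc p) →-dec bit (n + (p + suc p)) Bool.≟ true) 34) 384)

  -- The letter just after the square differs from the one a period earlier, so the square does not
  -- extend to an overlap.
  short-square-not-overlap : ∀ {n} → n < 384 → ∀ {p} → p < 34 → Square W n (suc p) →
                             W (n + suc p) ≢ W (n + (suc p + suc p))
  short-square-not-overlap = from-yes (allUpTo? (λ n → allUpTo? (λ p →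
    square? _≟_ W n (suc p) →-dec ¬? (W (n + suc p) ≟ W (n + (suc p + suc p)))) 34) 384)

  -- In a window of ten letters, a square of period `suc p` that ends at the last one starts at
  -- `8 ∸ 2 * p`.
  bit-short-square : ∀ {n} → n < 384 → bit (n + 9) ≡ true →
                     ∃[ p ] p < 5 × Square W (n + (8 ∸ 2 * p)) (suc p)
  bit-short-square = from-yes (allUpTo? (λ n →
    bit (n + 9) Bool.≟ true →-dec anyUpTo? (λ p → square? _≟_ W (n + (8 ∸ 2 * p)) (suc p)) 5) 384)

  -- The first nine positions of `w` have no full window of ten letters before them, so the squares
  -- are sought within `w` itself.
  bit-start-square : ∀ {n} → n < 9 → bit (11 + n) ≡ true →
                     ∃[ i ] i < suc n × ∃[ p ] p < 5 × i + (suc p + suc p) ≡ suc n × Square w i (suc p)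
  bit-start-square = from-yes (allUpTo? (λ n → bit (11 + n) Bool.≟ true →-dec
    anyUpTo? (λ i → anyUpTo? (λ p →
      i + (suc p + suc p) ℕ.≟ suc n ×-dec square? _≟_ w i (suc p)) 5) (suc n)) 9)

  sync-384 : ∀ {n} → n < 384 → n % 32 ≡ 16 → ∀ {m} → m < 384 → Agree W n m 4 → m % 32 ≡ 16
  sync-384 = from-yes (allUpTo? (λ n → n % 32 ℕ.≟ 16 →-dec
    allUpTo? (λ m → agree? _≟_ W n m 4 →-dec m % 32 ℕ.≟ 16) 384) 384)

-- Transfer to the first 12 blocks

mod-cong : ∀ m n → m % 32 ≡ n % 32 → m mod 32 ≡ n mod 32
mod-cong m n eq = fromℕ<-cong (m % 32) (n % 32) eq (m%n<n m 32) (m%n<n n 32)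

W-block : ∀ j m → W (j * 32 + m) ≡ lookup (block (t (j + m / 32)) (t (j + suc (m / 32)))) (m mod 32)
W-block j m = begin
  W (j * 32 + m)
    ≡⟨ cong₂ (λ x r → lookup (block (t x) (t (suc x))) r)
         ([kn+m]/n≡k+m/n j m 32) (mod-cong (j * 32 + m) m ([kn+m]%n≡m%n j m 32)) ⟩
  lookup (block (t (j + m / 32)) (t (suc (j + m / 32)))) (m mod 32)
    ≡⟨ cong (λ x → lookup (block (t (j + m / 32)) (t x)) (m mod 32)) (+-suc j (m / 32)) ⟨
  lookup (block (t (j + m / 32)) (t (j + suc (m / 32)))) (m mod 32) ∎

-- Each block depends on two consecutive letters of `t`, so five letters fix four blocks, that is
-- 128 letters.
W-agree-32 : ∀ i j → Agree t i j 5 → Agree W (i * 32) (j * 32) 128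
W-agree-32 i j ag {k} k<128 = begin
  W (i * 32 + k)  ≡⟨ W-block i k ⟩
  _               ≡⟨ cong₂ (λ a b → lookup (block a b) (k mod 32)) (ag (m≤n⇒m≤1+n q<4)) (ag (s<s q<4)) ⟩
  _               ≡⟨ W-block j k ⟨
  W (j * 32 + k)  ∎
  where
  q<4 : k / 32 < 4
  q<4 = m<n*o⇒m/o<n k<128

-- The offset within the block is kept. It uses up at most 31 of the 128 matching letters, which
-- leaves 97.
recurrence : ∀ n → ∃[ n′ ] n′ < 384 × n % 32 ≡ n′ % 32 × Agree W n n′ 97 × Agree bit n n′ 97
recurrence n with t-recurrence (n / 32)
... | j′ , j′<12 , ag =
  j′ * 32 + r
  , <-≤-trans (+-monoʳ-< (j′ * 32) r<32) (subst (_≤ 384) (+-comm 32 (j′ * 32)) (*-monoˡ-≤ 32 j′<12))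
  , sym (trans ([kn+m]%n≡m%n j′ r 32) (m%n%n≡m%n n 32))
  , subst (λ x → Agree W x (j′ * 32 + r) 97) n≡
      (agree-shift W (n / 32 * 32) (j′ * 32) r (+-monoˡ-≤ 97 (s≤s⁻¹ r<32))
        (W-agree-32 (n / 32) j′ ag))
  , subst (λ x → Agree bit x (j′ * 32 + r) 97) n≡
      (agree-shift bit (n / 32 * 32) (j′ * 32) r (+-monoˡ-≤ 97 (s≤s⁻¹ r<32))
        bit-agree)
  where
  r = n % 32
  r<32 = m%n<n n 32
  n≡ : n / 32 * 32 + r ≡ n
  n≡ = m/n*n+m%n≡m n 32
  -- The shift by 16 inside `bit` is affordable: 144 letters of `t` are needed and 160 agree.
  bit-agree : Agree bit (n / 32 * 32) (j′ * 32) 128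
  bit-agree {k} k<128 = begin
    bit (n / 32 * 32 + k)       ≡⟨ cong t (+-swap 16 (n / 32 * 32) k) ⟩
    t (n / 32 * 32 + (16 + k))  ≡⟨ agree-32 (n / 32) j′ ag (<-≤-trans (+-monoʳ-< 16 k<128) (m≤m+n 144 16)) ⟩
    t (j′ * 32 + (16 + k))      ≡⟨ cong t (+-swap 16 (j′ * 32) k) ⟨
    bit (j′ * 32 + k)           ∎

-- Absence of long squares

decode-16 : Fin 4 → Bool × Bool
decode-16 0F = false , false
decode-16 1F = true  , true
decode-16 2F = true  , false
decode-16 3F = false , true

decode-block : ∀ a b → decode-16 (lookup (block a b) (16 mod 32)) ≡ (a , b)
decode-block false false = refl
decode-block false true  = refl
decode-block true  false = refl
decode-block true  true  = refl

decode-W : ∀ i → decode-16 (W (i * 32 + 16)) ≡ (t i , t (suc i))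
decode-W i = begin
  decode-16 (W (i * 32 + 16))                                    ≡⟨ cong decode-16 (W-block i 16) ⟩
  decode-16 (lookup (block (t (i + 0)) (t (i + 1))) (16 mod 32)) ≡⟨ decode-block _ _ ⟩
  (t (i + 0) , t (i + 1))
    ≡⟨ cong₂ (λ x y → t x , t y) (+-identityʳ i) (+-comm i 1) ⟩
  (t i , t (suc i)) ∎

next-16 : ∀ i → ∃[ a ] ∃[ d ] d < 32 × a * 32 + 16 ≡ i + d
-- Rounding `(i - 16) / 32` up gives `(i + 15) / 32`. Adding `15 + r` to both sides clears the
-- truncated subtraction.
next-16 i = (i + 15) / 32 , 31 ∸ r , s≤s (m∸n≤m 31 r) , +-cancelʳ-≡ (15 + r) _ _ (begin
    a * 32 + 16 + (15 + r)     ≡⟨ +-assoc (a * 32) 16 (15 + r) ⟩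
    a * 32 + (31 + r)          ≡⟨ cong (a * 32 +_) (+-comm 31 r) ⟩
    a * 32 + (r + 31)          ≡⟨ +-assoc (a * 32) r 31 ⟨
    a * 32 + r + 31            ≡⟨ cong (_+ 31) (m/n*n+m%n≡m (i + 15) 32) ⟩
    i + 15 + 31                ≡⟨ cong (i + 15 +_) (m∸n+n≡m r≤31) ⟨
    i + 15 + (31 ∸ r + r)      ≡⟨ +-assoc i 15 (31 ∸ r + r) ⟩
    i + (15 + (31 ∸ r + r))    ≡⟨ cong (i +_) (+-swap 15 (31 ∸ r) r) ⟩
    i + (31 ∸ r + (15 + r))    ≡⟨ +-assoc i (31 ∸ r) (15 + r) ⟨
    i + (31 ∸ r) + (15 + r)    ∎)
  where
  a = (i + 15) / 32
  r = (i + 15) % 32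
  r≤31 : r ≤ 31
  r≤31 = s≤s⁻¹ (m%n<n (i + 15) 32)

-- Both factors move into the first 12 blocks with their offsets modulo 32 unchanged, where the
-- finite check applies.
W-sync : ∀ n m → n % 32 ≡ 16 → Agree W n m 4 → m % 32 ≡ 16
W-sync n m n≡16 ag =
  let n′ , n′< , n≡n′ , agn , _ = recurrence n
      m′ , m′< , m≡m′ , agm , _ = recurrence m
  in trans m≡m′ (sync-384 n′< (trans (sym n≡n′) n≡16) m′<
       (λ k<4 → trans (sym (agn (k<97 k<4))) (trans (ag k<4) (agm (k<97 k<4)))))
  where
  k<97 : ∀ {k} → k < 4 → k < 97
  k<97 k<4 = ≤-trans k<4 (m≤m+n 4 93)

-- Since 35 is 31 + 4, the first half of the square contains a position of offset 16 together with
-- the next three letters; their copy one period later forces `32 ∣ p`.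
W-no-long-square′ : ∀ i p a d → d < 32 → a * 32 + 16 ≡ i + d → 35 ≤ p → ¬ Square W i p
W-no-long-square′ i p a d d<32 a≡ 35≤p sq = from-divisor 32∣p
  where
  d≤31 : d ≤ 31
  d≤31 = s≤s⁻¹ d<32

  sq-at : ∀ {k} → d + k < p → W (a * 32 + 16 + k) ≡ W (a * 32 + 16 + (p + k))
  sq-at {k} d+k<p = begin
    W (a * 32 + 16 + k)        ≡⟨ cong (λ x → W (x + k)) a≡ ⟩
    W (i + d + k)              ≡⟨ cong W (+-assoc i d k) ⟩
    W (i + (d + k))            ≡⟨ sq d+k<p ⟩
    W (i + (p + (d + k)))      ≡⟨ cong (λ x → W (i + x)) (+-swap p d k) ⟩
    W (i + (d + (p + k)))      ≡⟨ cong W (+-assoc i d (p + k)) ⟨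
    W (i + d + (p + k))        ≡⟨ cong (λ x → W (x + (p + k))) a≡ ⟨
    W (a * 32 + 16 + (p + k))  ∎

  p-sync : (a * 32 + 16 + p) % 32 ≡ 16
  p-sync = W-sync (a * 32 + 16) (a * 32 + 16 + p) ([kn+m]%n≡m%n a 16 32)
    (λ {k} k<4 → trans (sq-at (<-≤-trans (+-mono-≤-< d≤31 k<4) 35≤p))
                   (cong W (sym (+-assoc (a * 32 + 16) p k))))

  32∣p : 32 ∣ p
  32∣p = ∣m+n∣m⇒∣n (divides b (+-cancelʳ-≡ 16 _ _ (begin
    a * 32 + p + 16      ≡⟨ +-assoc (a * 32) p 16 ⟩
    a * 32 + (p + 16)    ≡⟨ cong (a * 32 +_) (+-comm p 16) ⟩
    a * 32 + (16 + p)    ≡⟨ +-assoc (a * 32) 16 p ⟨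
    m                    ≡⟨ m/n*n+m%n≡m m 32 ⟨
    b * 32 + m % 32      ≡⟨ cong (b * 32 +_) p-sync ⟩
    b * 32 + 16          ∎))) (n∣m*n a)
    where
    m = a * 32 + 16 + p
    b = m / 32

  from-divisor : ¬ (32 ∣ p)
  from-divisor (divides zero    refl) = contradiction 35≤p λ ()
  from-divisor (divides (suc q) refl) = t-no-overlap q a t-overlap
    where
    shift : ∀ n → n * 32 + (a * 32 + 16) ≡ (a + n) * 32 + 16
    shift n = begin
      n * 32 + (a * 32 + 16)  ≡⟨ +-assoc (n * 32) (a * 32) 16 ⟨
      n * 32 + a * 32 + 16    ≡⟨ cong (_+ 16) (+-comm (n * 32) (a * 32)) ⟩
      a * 32 + n * 32 + 16    ≡⟨ cong (_+ 16) (*-distribʳ-+ 32 a n) ⟨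
      (a + n) * 32 + 16       ∎

    pair : ∀ {k} → k < suc q →
           (t (a + k) , t (suc (a + k))) ≡ (t (a + (suc q + k)) , t (suc (a + (suc q + k))))
    pair {k} k≤q = trans (sym (decode-W (a + k))) (trans (cong decode-16 (begin
      W ((a + k) * 32 + 16)                  ≡⟨ cong W (shift k) ⟨
      W (k * 32 + (a * 32 + 16))             ≡⟨ cong W (+-comm (k * 32) (a * 32 + 16)) ⟩
      W (a * 32 + 16 + k * 32)               ≡⟨ sq-at (<-≤-trans (+-monoˡ-< (k * 32) d<32) (*-monoˡ-≤ 32 k≤q)) ⟩
      W (a * 32 + 16 + (suc q * 32 + k * 32))
        ≡⟨ cong (λ x → W (a * 32 + 16 + x)) (*-distribʳ-+ 32 (suc q) k) ⟨
      W (a * 32 + 16 + (suc q + k) * 32)     ≡⟨ cong W (+-comm (a * 32 + 16) ((suc q + k) * 32)) ⟩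
      W ((suc q + k) * 32 + (a * 32 + 16))   ≡⟨ cong W (shift (suc q + k)) ⟩
      W ((a + (suc q + k)) * 32 + 16)        ∎))
      (decode-W (a + (suc q + k))))

    -- Place 0 is read from the first component and place `suc k` from the second component at `k`,
    -- so `suc q` pairs settle one place more than a square would.
    t-overlap : Overlap t a (suc q)
    t-overlap {zero}  _         = cong proj₁ (pair z<s)
    t-overlap {suc k} (s≤s k<p) = trans (cong t (+-suc a k)) (trans (cong proj₂ (pair k<p))
      (cong t (trans (sym (+-suc a (suc q + k))) (cong (a +_) (sym (+-suc (suc q) k))))))

W-no-long-square : ∀ i p → 35 ≤ p → ¬ Square W i p
W-no-long-square i p 35≤p sq =
  let a , d , d<32 , a≡ = next-16 i in W-no-long-square′ i p a d d<32 a≡ 35≤p sq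

-- Squares of `W` and of `w`

short-square : ∀ n {p} → p < 34 → Square W n (suc p) →
               bit (n + (p + suc p)) ≡ true × W (n + suc p) ≢ W (n + (suc p + suc p))
short-square n {p} p<34 sq =
  let n′ , n′<384 , _ , agW , agBit = recurrence n
      sq′ : Square W n′ (suc p)
      sq′ = λ k≤p → trans (sym (agW (below k≤p)))
              (trans (sq k≤p) (agW (<-trans (+-monoʳ-< (suc p) k≤p) 2p<97)))
  in trans (agBit (<-trans ≤-refl 2p<97)) (short-square-bit n′<384 p<34 sq′)
   , λ eq → short-square-not-overlap n′<384 p<34 sq′
       (trans (sym (agW p<97)) (trans eq (agW 2p<97)))
  where
  -- The period is at most 34, so the square and the letter after it span at most 69 of the 97
  -- positions.
  2p<97 : suc p + suc p < 97
  2p<97 = ≤-<-trans (+-mono-≤ p<34 p<34) (m≤m+n 69 28)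
  p<97 : suc p < 97
  p<97 = ≤-<-trans p<34 (m≤m+n 35 62)
  below : ∀ {k} → k < suc p → k < 97
  below k≤p = <-trans k≤p p<97

W-square : ∀ n p → Square W n (suc p) →
           bit (n + (p + suc p)) ≡ true × W (n + suc p) ≢ W (n + (suc p + suc p))
W-square n p sq with p <? 34
... | yes p<34 = short-square n p<34 sq
... | no  p≮34 = ⊥-elim (W-no-long-square n (suc p) (s≤s (≮⇒≥ p≮34)) sq)

w-square-bit : ∀ n → SquareEndingAt w n → bit (11 + n) ≡ true
w-square-bit n (i , p , end , sq) =
  subst (λ m → bit (11 + m) ≡ true) (suc-injective (trans (sym (+-suc i (p + suc p))) end))
    (proj₁ (W-square (11 + i) p sq))

-- From `n = 9` on, the ten letters of `W` ending at `11 + n` all belong to `w`, so the square found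
-- in that window lies in `w`.
bit-w-square : ∀ n → bit (11 + n) ≡ true → SquareEndingAt w n
bit-w-square n b with n <? 9
... | yes n<9 = let i , _ , p , _ , end , sq = bit-start-square n<9 b in i , p , end , sq
... | no  n≮9 = late (n ∸ 9) (m∸n+n≡m (≮⇒≥ n≮9))
  where
  late : ∀ m → m + 9 ≡ n → SquareEndingAt w n
  late m refl =
    let n′ , n′<384 , _ , agW , agBit = recurrence (11 + m)
        p , p<5 , sq = bit-short-square n′<384 (trans (sym (agBit (m≤m+n 10 87))) b)
        e = 8 ∸ 2 * p
        at : ∀ {k} → k < suc p + suc p → W (11 + m + (e + k)) ≡ W (n′ + (e + k))
        at = λ {k} k<2p → agW (<-≤-trans
               (+-mono-≤-< (m∸n≤m 8 (2 * p)) (<-≤-trans k<2p (+-mono-≤ p<5 p<5))) (m≤m+n 18 79))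
    in m + e , p
     , (begin
          m + e + (suc p + suc p)    ≡⟨ +-assoc m e (suc p + suc p) ⟩
          m + (e + (suc p + suc p))  ≡⟨ cong (m +_) (end p p<5) ⟩
          m + 10                     ≡⟨ +-suc m 9 ⟩
          suc (m + 9)                ∎)
     , λ {k} k≤p → begin
          W (11 + (m + e + k))                ≡⟨ cong (λ x → W (11 + x)) (+-assoc m e k) ⟩
          W (11 + m + (e + k))                ≡⟨ at (m≤n⇒m≤n+o (suc p) k≤p) ⟩
          W (n′ + (e + k))                    ≡⟨ cong W (+-assoc n′ e k) ⟨
          W (n′ + e + k)                      ≡⟨ sq k≤p ⟩
          W (n′ + e + (suc p + k))            ≡⟨ cong W (+-assoc n′ e (suc p + k)) ⟩
          W (n′ + (e + (suc p + k)))          ≡⟨ at (+-monoʳ-< (suc p) k≤p) ⟨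
          W (11 + m + (e + (suc p + k)))      ≡⟨ cong (λ x → W (11 + x)) (+-assoc m e (suc p + k)) ⟨
          W (11 + (m + e + (suc p + k)))      ∎
    where
    end : ∀ p → p < 5 → 8 ∸ 2 * p + (suc p + suc p) ≡ 10
    end 0 _ = refl
    end 1 _ = refl
    end 2 _ = refl
    end 3 _ = refl
    end 4 _ = refl
    end (suc (suc (suc (suc (suc _))))) (s≤s (s≤s (s≤s (s≤s (s≤s ())))))

-- Overlap-freeness of `w` and of its curling-number transform

w-no-overlap : NoOverlap w
w-no-overlap i p ov = proj₂ (W-square (11 + i) p (λ k≤p → ov (m≤n⇒m≤1+n k≤p))) (ov ≤-refl)

curl : Bool → ℕ
curl false = 1
curl true  = 2

curl-injective : ∀ {a b} → curl a ≡ curl b → a ≡ b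
curl-injective {false} {false} _ = refl
curl-injective {true}  {true}  _ = refl

-- The shift 27 is 16 from `bit` plus 11 from `w`. Squares end exactly where `bit` is true, and `w`
-- has no overlaps, so 1 and 2 are the only values.
C-w : ∀ n → C _≟_ w n ≡ curl (t (27 + n))
C-w n with t (27 + n) in eq
... | true  = C≡2 _≟_ w n w-no-overlap (bit-w-square n eq)
... | false = C≡1 _≟_ w n λ sq → contradiction (trans (sym eq) (w-square-bit n sq)) λ ()

-- As `curl` is injective, an overlap here would give one of the same period in `t`.
C-w-no-overlap : NoOverlap (C _≟_ w)
C-w-no-overlap i p ov = t-no-overlap p (27 + i) λ {k} k≤p →
  curl-injective (trans (sym (C-w (i + k))) (trans (ov k≤p) (C-w (i + (suc p + k)))))

theorem12 : ∃[ w ] OverlapFree {Fin 4} w × OverlapFree (C _≟_ w)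
theorem12 = w , NoOverlap⇒OverlapFree w w-no-overlap , NoOverlap⇒OverlapFree (C _≟_ w) C-w-no-overlap
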